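{- Let $X$ be the higher inductive type with constructors $\mathrm{pt} : X$, $a, b : \Omega X$, $r : a^5 = b^3$, and $s : b^3 = (ab)^2$. Then there is a $0$-connected map $X \to \mathrm{B}\mathrm{A}_5$, where $\mathrm{B}\mathrm{A}_5$ is the classifying type of the alternating group $\mathrm{A}_5$.
   Context: We work in homotopy type theory (HoTT) in the style of the HoTT Book: dependent type theory with univalent universes (hence function extensionality) and higher inductive types; no classical axioms are assumed. $\Omega X$ denotes the loop type $(\mathrm{pt} =_X \mathrm{pt})$; products and powers of loops are with respect to path concatenation. A map is $0$-connected if the set truncation of each of its fibers is contractible. The classifying type $\mathrm{B}G$ of a group $G$ is the ($0$-connected, pointed) $1$-type with a group isomorphism $G \cong (\mathrm{pt} =_{\mathrm{B}G} \mathrm{pt})$. -}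

module Defs where

open import Agda.Primitive using (Level; lzero; lsuc; _⊔_; Setω)
open import Data.Empty using (⊥; ⊥-elim)
open import Data.Nat.Base using (ℕ; zero; suc; _+_; _*_)
open import Data.Nat.Properties using (*-distribʳ-+; +-comm)
open import Data.Product.Base using (Σ; _,_; proj₁; proj₂)
open import Data.Sum.Base using (_⊎_; inj₁; inj₂)
open import Data.Unit.Base using (⊤; tt)
open import Function.Base using (_∘_; id)
open import Relation.Binary.PropositionalEquality.Core as ≡ using (_≡_)

-- Homotopy type theory is embedded as the inner layer of a two-level type
-- theory (Annenkov, Capriotti, Kraus, Sattler).  Agda's own types form the
-- outer, strict layer; `Fibrant A` says that A is a type of homotopy type
-- theory, and `Type ℓ` is its ℓ-th universe.  Inner Π- and Σ-types coincide with
-- the outer ones.  The identity type `Id` is not Agda's `_≡_`: it eliminates only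
-- into fibrant families, so univalence and nontrivial loops are compatible with
-- Axiom K for `_≡_` (as in Kan simplicial or cubical sets).  `_≡_` plays the part
-- of judgemental equality and occurs only in computation rules.

record MLTT : Setω where
  field
    Fibrant : ∀ {ℓ} → Set ℓ → Set (lsuc ℓ)

  Type : ∀ ℓ → Set (lsuc ℓ)
  Type ℓ = Σ (Set ℓ) Fibrant

  ⟨_⟩ : ∀ {ℓ} → Type ℓ → Set ℓ
  ⟨ A ⟩ = proj₁ A

  field
    Π-fibrant : ∀ {k ℓ} (A : Type k) (B : ⟨ A ⟩ → Type ℓ) →
                Fibrant ((x : ⟨ A ⟩) → ⟨ B x ⟩)
    Σ-fibrant : ∀ {k ℓ} (A : Type k) (B : ⟨ A ⟩ → Type ℓ) →
                Fibrant (Σ ⟨ A ⟩ λ x → ⟨ B x ⟩)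
    ⊎-fibrant : ∀ {k ℓ} (A : Type k) (B : Type ℓ) → Fibrant (⟨ A ⟩ ⊎ ⟨ B ⟩)
    ⊥-fibrant : Fibrant ⊥
    ⊤-fibrant : Fibrant ⊤
    ℕ-fibrant : Fibrant ℕ
    Type-fibrant : ∀ ℓ → Fibrant (Type ℓ)

    Id   : ∀ {ℓ} (A : Type ℓ) → ⟨ A ⟩ → ⟨ A ⟩ → Type ℓ
    refl : ∀ {ℓ} (A : Type ℓ) (x : ⟨ A ⟩) → ⟨ Id A x x ⟩
    J    : ∀ {k ℓ} (A : Type k) {x : ⟨ A ⟩}
           (P : (y : ⟨ A ⟩) → ⟨ Id A x y ⟩ → Type ℓ) →
           ⟨ P x (refl A x) ⟩ → ∀ {y} (p : ⟨ Id A x y ⟩) → ⟨ P y p ⟩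
    J-β  : ∀ {k ℓ} (A : Type k) {x : ⟨ A ⟩}
           (P : (y : ⟨ A ⟩) → ⟨ Id A x y ⟩ → Type ℓ) (d : ⟨ P x (refl A x) ⟩) →
           J A P d (refl A x) ≡ d

module Basics (T : MLTT) where
  open MLTT T public

  infixr 4 _⇒_ _≃_
  infixr 5 _×′_

  Π′ : ∀ {k ℓ} (A : Type k) (B : ⟨ A ⟩ → Type ℓ) → Type (k ⊔ ℓ)
  Π′ A B = ((x : ⟨ A ⟩) → ⟨ B x ⟩) , Π-fibrant A B

  Σ′ : ∀ {k ℓ} (A : Type k) (B : ⟨ A ⟩ → Type ℓ) → Type (k ⊔ ℓ)
  Σ′ A B = (Σ ⟨ A ⟩ λ x → ⟨ B x ⟩) , Σ-fibrant A B

  _⇒_ : ∀ {k ℓ} → Type k → Type ℓ → Type (k ⊔ ℓ)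
  A ⇒ B = Π′ A λ _ → B

  _×′_ : ∀ {k ℓ} → Type k → Type ℓ → Type (k ⊔ ℓ)
  A ×′ B = Σ′ A λ _ → B

  _⊎′_ : ∀ {k ℓ} → Type k → Type ℓ → Type (k ⊔ ℓ)
  A ⊎′ B = (⟨ A ⟩ ⊎ ⟨ B ⟩) , ⊎-fibrant A B

  ⊥′ ⊤′ ℕ′ : Type lzero
  ⊥′ = ⊥ , ⊥-fibrant
  ⊤′ = ⊤ , ⊤-fibrant
  ℕ′ = ℕ , ℕ-fibrant

  𝒰 : ∀ ℓ → Type (lsuc ℓ)
  𝒰 ℓ = Type ℓ , Type-fibrant ℓ

  isContr : ∀ {ℓ} → Type ℓ → Type ℓ
  isContr A = Σ′ A λ x → Π′ A λ y → Id A x y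

  fiber : ∀ {k ℓ} (A : Type k) (B : Type ℓ) → (⟨ A ⟩ → ⟨ B ⟩) → ⟨ B ⟩ → Type (k ⊔ ℓ)
  fiber A B f y = Σ′ A λ x → Id B (f x) y

  isEquiv : ∀ {k ℓ} (A : Type k) (B : Type ℓ) → (⟨ A ⟩ → ⟨ B ⟩) → Type (k ⊔ ℓ)
  isEquiv A B f = Π′ B λ y → isContr (fiber A B f y)

  _≃_ : ∀ {k ℓ} → Type k → Type ℓ → Type (k ⊔ ℓ)
  A ≃ B = Σ′ (A ⇒ B) (isEquiv A B)

  idEquiv : ∀ {ℓ} (A : Type ℓ) → ⟨ A ≃ A ⟩
  idEquiv A = id , λ y → (y , refl A y) , λ (x , p) →
    J A (λ z q → Id (fiber A A id z) (z , refl A z) (x , q)) (refl (fiber A A id x) (x , refl A x)) p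

  idToEquiv : ∀ {ℓ} {A B : Type ℓ} → ⟨ Id (𝒰 ℓ) A B ⟩ → ⟨ A ≃ B ⟩
  idToEquiv {ℓ} {A} = J (𝒰 ℓ) (λ B _ → A ≃ B) (idEquiv A)

  -- hasLevel n A : A is an (n - 2)-type.
  hasLevel : ∀ {ℓ} → ℕ → Type ℓ → Type ℓ
  hasLevel zero    A = isContr A
  hasLevel (suc n) A = Π′ A λ x → Π′ A λ y → hasLevel n (Id A x y)

record HoTT : Setω where
  field
    mltt : MLTT

  open Basics mltt public

  field
    univalence : ∀ {ℓ} (A B : Type ℓ) →
                 ⟨ isEquiv (Id (𝒰 ℓ) A B) (A ≃ B) idToEquiv ⟩

    -- A consequence of univalence, included for convenience.
    funext : ∀ {k ℓ} (A : Type k) (B : ⟨ A ⟩ → Type ℓ) (f g : (x : ⟨ A ⟩) → ⟨ B x ⟩) →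
             ((x : ⟨ A ⟩) → ⟨ Id (B x) (f x) (g x) ⟩) → ⟨ Id (Π′ A B) f g ⟩

    -- Trunc n A is the (n - 1)-truncation of A: propositional for n = 0,
    -- set truncation for n = 1.
    Trunc       : ∀ {ℓ} → ℕ → Type ℓ → Type ℓ
    Trunc-level : ∀ {ℓ} n (A : Type ℓ) → ⟨ hasLevel (suc n) (Trunc n A) ⟩
    trunc       : ∀ {ℓ} n (A : Type ℓ) → ⟨ A ⟩ → ⟨ Trunc n A ⟩
    Trunc-elim  : ∀ {k ℓ} n (A : Type k) (P : ⟨ Trunc n A ⟩ → Type ℓ) →
                  (∀ t → ⟨ hasLevel (suc n) (P t) ⟩) →
                  (∀ x → ⟨ P (trunc n A x) ⟩) → ∀ t → ⟨ P t ⟩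
    Trunc-β     : ∀ {k ℓ} n (A : Type k) (P : ⟨ Trunc n A ⟩ → Type ℓ)
                  (h : ∀ t → ⟨ hasLevel (suc n) (P t) ⟩)
                  (f : ∀ x → ⟨ P (trunc n A x) ⟩) (x : ⟨ A ⟩) →
                  Trunc-elim n A P h f (trunc n A x) ≡ f x

module Theory (H : HoTT) where
  open HoTT H public

  private variable
    k ℓ : Level

  is0ConnectedType : Type ℓ → Type ℓ
  is0ConnectedType A = isContr (Trunc 1 A)

  is0Connected : (A : Type k) (B : Type ℓ) → (⟨ A ⟩ → ⟨ B ⟩) → Type (k ⊔ ℓ)
  is0Connected A B f = Π′ B λ y → is0ConnectedType (fiber A B f y)

  isSet : Type ℓ → Type ℓ
  isSet = hasLevel 2

  reflexive : {A : Type ℓ} → ∀ {x y} → x ≡ y → ⟨ Id A x y ⟩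
  reflexive {A = A} {x} ≡.refl = refl A x

  module _ {A : Type ℓ} where
    infixr 7 _∙_
    infix  8 _^_

    _∙_ : ∀ {x y z} → ⟨ Id A x y ⟩ → ⟨ Id A y z ⟩ → ⟨ Id A x z ⟩
    _∙_ {x} p q = J A (λ z _ → Id A x z) p q

    sym : ∀ {x y} → ⟨ Id A x y ⟩ → ⟨ Id A y x ⟩
    sym {x} = J A (λ y _ → Id A y x) (refl A x)

    _^_ : ∀ {x} → ⟨ Id A x x ⟩ → ℕ → ⟨ Id A x x ⟩
    _^_ {x} p zero    = refl A x
    _^_ {x} p (suc n) = p ^ n ∙ p

    ∙-refl : ∀ {x y} (p : ⟨ Id A x y ⟩) → p ∙ refl A y ≡ p
    ∙-refl {x} p = J-β A (λ z _ → Id A x z) p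

    sym-∙ : ∀ {x y} (p : ⟨ Id A x y ⟩) → ⟨ Id (Id A y y) (sym p ∙ p) (refl A y) ⟩
    sym-∙ {x} = J A (λ y p → Id (Id A y y) (sym p ∙ p) (refl A y))
      (≡.subst (λ q → ⟨ Id (Id A x x) q (refl A x) ⟩)
        (≡.sym (≡.trans (∙-refl _) (J-β A (λ y _ → Id A y x) (refl A x))))
        (refl (Id A x x) (refl A x)))

    transport : (P : ⟨ A ⟩ → Type k) → ∀ {x y} → ⟨ Id A x y ⟩ → ⟨ P x ⟩ → ⟨ P y ⟩
    transport P {x} p = J A (λ y _ → P x ⇒ P y) id p

    transport-refl : (P : ⟨ A ⟩ → Type k) → ∀ x → transport P (refl A x) ≡ id
    transport-refl P x = J-β A (λ y _ → P x ⇒ P y) id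

    refl-∙ : ∀ {x y} (p : ⟨ Id A x y ⟩) → ⟨ Id (Id A x y) (refl A x ∙ p) p ⟩
    refl-∙ {x} = J A (λ y p → Id (Id A x y) (refl A x ∙ p) p) (reflexive (∙-refl (refl A x)))

  ap : {A : Type k} {B : Type ℓ} (f : ⟨ A ⟩ → ⟨ B ⟩) → ∀ {x y} →
       ⟨ Id A x y ⟩ → ⟨ Id B (f x) (f y) ⟩
  ap {A = A} {B} f {x} = J A (λ y _ → Id B (f x) (f y)) (refl B (f x))

  ap-id : {A : Type k} → ∀ {x y} (p : ⟨ Id A x y ⟩) → ⟨ Id (Id A x y) (ap {B = A} id p) p ⟩
  ap-id {A = A} {x} = J A (λ y p → Id (Id A x y) (ap {B = A} id p) p)
    (reflexive (J-β A (λ y _ → Id A x y) (refl A x)))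

  module _ {A : Type k} (P : ⟨ A ⟩ → Type ℓ) where
    PathOver : ∀ {x y} → ⟨ Id A x y ⟩ → ⟨ P x ⟩ → ⟨ P y ⟩ → Type ℓ
    PathOver {y = y} p u v = Id (P y) (transport P p u) v

    reflᵈ : ∀ {x} (u : ⟨ P x ⟩) → ⟨ PathOver (refl A x) u u ⟩
    reflᵈ {x} u = reflexive (≡.cong (λ t → t u) (transport-refl P x))

    transport-∙ : ∀ {x y z} (p : ⟨ Id A x y ⟩) (q : ⟨ Id A y z ⟩) (u : ⟨ P x ⟩) →
                  ⟨ Id (P z) (transport P (p ∙ q) u) (transport P q (transport P p u)) ⟩
    transport-∙ {y = y} p q u =
      J A (λ z q → Id (P z) (transport P (p ∙ q) u) (transport P q (transport P p u)))
        (reflexive (≡.trans (≡.cong (λ r → transport P r u) (∙-refl p))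
                            (≡.sym (≡.cong (λ t → t (transport P p u)) (transport-refl P y)))))
        q

    concatᵈ : ∀ {x y z} {p : ⟨ Id A x y ⟩} {q : ⟨ Id A y z ⟩} {u v w} →
              ⟨ PathOver p u v ⟩ → ⟨ PathOver q v w ⟩ → ⟨ PathOver (p ∙ q) u w ⟩
    concatᵈ {p = p} {q} {u} p′ q′ = transport-∙ p q u ∙ (ap (transport P q) p′ ∙ q′)

    powerᵈ : ∀ {x} {p : ⟨ Id A x x ⟩} {u} → ⟨ PathOver p u u ⟩ → ∀ n → ⟨ PathOver (p ^ n) u u ⟩
    powerᵈ p′ zero    = reflᵈ _
    powerᵈ p′ (suc n) = concatᵈ (powerᵈ p′ n) p′

    apd : (f : (x : ⟨ A ⟩) → ⟨ P x ⟩) → ∀ {x y} (p : ⟨ Id A x y ⟩) → ⟨ PathOver p (f x) (f y) ⟩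
    apd f {x} = J A (λ y p → PathOver p (f x) (f y)) (reflᵈ (f x))

    apd-∙ : (f : (x : ⟨ A ⟩) → ⟨ P x ⟩) → ∀ {x y z} (p : ⟨ Id A x y ⟩) (q : ⟨ Id A y z ⟩) →
            ⟨ Id (PathOver (p ∙ q) (f x) (f z)) (apd f (p ∙ q)) (concatᵈ (apd f p) (apd f q)) ⟩
    apd-∙ f {x} {y} p = J A
      (λ z q → Id (PathOver (p ∙ q) (f x) (f z)) (apd f (p ∙ q)) (concatᵈ (apd f p) (apd f q)))
      (base (∙-refl p) (transport-refl P y)
        (J-β A (λ z q → Id (P z) (transport P (p ∙ q) (f x)) (transport P q (transport P p (f x)))) _)
        (J-β A (λ z q → PathOver q (f y) (f z)) (reflᵈ (f y))))
      where
      base : ∀ {r} {t} (e : r ≡ p) (e′ : t ≡ id) {c d} →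
             c ≡ reflexive (≡.trans (≡.cong (λ r → transport P r (f x)) e)
                             (≡.sym (≡.cong (λ t → t (transport P p (f x))) e′))) →
             d ≡ reflexive (≡.cong (λ t → t (f y)) e′) →
             ⟨ Id (PathOver r (f x) (f y)) (apd f r) (c ∙ (ap t (apd f p) ∙ d)) ⟩
      base ≡.refl ≡.refl ≡.refl ≡.refl =
        sym (refl-∙ _ ∙ (reflexive (∙-refl _) ∙ ap-id (apd f p)))

    apd-^ : (f : (x : ⟨ A ⟩) → ⟨ P x ⟩) → ∀ {x} (p : ⟨ Id A x x ⟩) n →
            ⟨ Id (PathOver (p ^ n) (f x) (f x)) (apd f (p ^ n)) (powerᵈ (apd f p) n) ⟩
    apd-^ f {x} p zero    = reflexive (J-β A (λ y p → PathOver p (f x) (f y)) (reflᵈ (f x)))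
    apd-^ f {x} p (suc n) =
      apd-∙ f (p ^ n) p ∙ ap (λ t → concatᵈ t (apd f p)) (apd-^ f p n)

  record Constructors (X : Type lzero) : Set where
    field
      pt  : ⟨ X ⟩
      a b : ⟨ Id X pt pt ⟩
      r   : ⟨ Id (Id X pt pt) (a ^ 5) (b ^ 3) ⟩
      s   : ⟨ Id (Id X pt pt) (b ^ 3) ((a ∙ b) ^ 2) ⟩

  module _ {X : Type lzero} (c : Constructors X) (P : ⟨ X ⟩ → Type ℓ) where
    open Constructors c

    Loopsᵈ : ⟨ P pt ⟩ → ⟨ Id X pt pt ⟩ → Type ℓ
    Loopsᵈ u p = PathOver P p u u

    Methods : ⟨ P pt ⟩ → Type ℓ
    Methods u =
      Σ′ (Loopsᵈ u a) λ a′ →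
      Σ′ (Loopsᵈ u b) λ b′ →
      PathOver (Loopsᵈ u) r (powerᵈ P a′ 5) (powerᵈ P b′ 3) ×′
      PathOver (Loopsᵈ u) s (powerᵈ P b′ 3) (powerᵈ P (concatᵈ P a′ b′) 2)

    -- The action of a dependent function on the path constructors, with the
    -- endpoints in the last two components rewritten by functoriality of apd.
    methods : (f : (x : ⟨ X ⟩) → ⟨ P x ⟩) → ⟨ Methods (f pt) ⟩
    methods f =
      apd P f a ,
      apd P f b ,
      rebase r (apd-^ P f a 5) (apd-^ P f b 3) ,
      rebase s (apd-^ P f b 3)
        (apd-^ P f (a ∙ b) 2 ∙ ap (λ t → powerᵈ P t 2) (apd-∙ P f a b))
      where
      rebase : ∀ {p q p′ q′} (t : ⟨ Id (Id X pt pt) p q ⟩) →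
               ⟨ Id (Loopsᵈ (f pt) p) (apd P f p) p′ ⟩ →
               ⟨ Id (Loopsᵈ (f pt) q) (apd P f q) q′ ⟩ →
               ⟨ PathOver (Loopsᵈ (f pt)) t p′ q′ ⟩
      rebase t h h′ =
        ap (transport (Loopsᵈ (f pt)) t) (sym h) ∙ (apd (Loopsᵈ (f pt)) (apd P f) t ∙ h′)

  -- The induction principle, with a judgemental computation rule for the point
  -- constructor and typal ones for the path constructors; the latter are
  -- stated together, as one identification of tuples of methods.
  record IsHIT (X : Type lzero) (c : Constructors X) : Setω where
    open Constructors c
    field
      elim       : ∀ {ℓ} (P : ⟨ X ⟩ → Type ℓ) (u : ⟨ P pt ⟩) → ⟨ Methods c P u ⟩ →
                   (x : ⟨ X ⟩) → ⟨ P x ⟩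
      elim-point : ∀ {ℓ} (P : ⟨ X ⟩ → Type ℓ) (u : ⟨ P pt ⟩) (m : ⟨ Methods c P u ⟩) →
                   elim P u m pt ≡ u
      elim-paths : ∀ {ℓ} (P : ⟨ X ⟩ → Type ℓ) (u : ⟨ P pt ⟩) (m : ⟨ Methods c P u ⟩) →
                   ⟨ Id (Methods c P u)
                       (≡.subst (λ v → ⟨ Methods c P v ⟩) (elim-point P u m)
                         (methods c P (elim P u m)))
                       m ⟩

  record Group ℓ : Set (lsuc ℓ) where
    infixl 7 _·_
    field
      Carrier : Type ℓ
      set     : ⟨ isSet Carrier ⟩
      _·_     : ⟨ Carrier ⟩ → ⟨ Carrier ⟩ → ⟨ Carrier ⟩
      ε       : ⟨ Carrier ⟩
      _⁻¹     : ⟨ Carrier ⟩ → ⟨ Carrier ⟩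
      assoc   : ∀ x y z → ⟨ Id Carrier ((x · y) · z) (x · (y · z)) ⟩
      unitˡ   : ∀ x → ⟨ Id Carrier (ε · x) x ⟩
      unitʳ   : ∀ x → ⟨ Id Carrier (x · ε) x ⟩
      invˡ    : ∀ x → ⟨ Id Carrier (x ⁻¹ · x) ε ⟩
      invʳ    : ∀ x → ⟨ Id Carrier (x · x ⁻¹) ε ⟩

  record IsClassifyingType (G : Group k) (B : Type ℓ) : Set (k ⊔ ℓ) where
    open Group G
    field
      pt        : ⟨ B ⟩
      connected : ⟨ is0ConnectedType B ⟩
      1-type    : ⟨ hasLevel 3 B ⟩
      iso       : ⟨ Carrier ≃ Id B pt pt ⟩
      iso-·     : ∀ x y → ⟨ Id (Id B pt pt) (proj₁ iso (x · y)) (proj₁ iso x ∙ proj₁ iso y) ⟩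

  isProp : Type ℓ → Type ℓ
  isProp A = Π′ A λ x → Π′ A λ y → Id A x y

  module _ {A : Type ℓ} where
    isContr→isProp : ⟨ isContr A ⟩ → ⟨ isProp A ⟩
    isContr→isProp (z , h) x y = sym (h x) ∙ h y

    level1→isProp : ⟨ hasLevel 1 A ⟩ → ⟨ isProp A ⟩
    level1→isProp h x y = proj₁ (h x y)

    isProp→level1 : ⟨ isProp A ⟩ → ⟨ hasLevel 1 A ⟩
    isProp→level1 h x y = sym (h x x) ∙ h x y ,
      J A (λ y p → Id (Id A x y) (sym (h x x) ∙ h x y) p) (sym-∙ (h x x))

  isPropΠ : {A : Type k} {B : ⟨ A ⟩ → Type ℓ} → (∀ x → ⟨ isProp (B x) ⟩) → ⟨ isProp (Π′ A B) ⟩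
  isPropΠ {A = A} {B} h f g = funext A B f g (λ x → h x (f x) (g x))

  subtype-≡ : {A : Type k} {B : ⟨ A ⟩ → Type ℓ} → (∀ x → ⟨ isProp (B x) ⟩) →
              ∀ {u v} → ⟨ Id A (proj₁ u) (proj₁ v) ⟩ → ⟨ Id (Σ′ A B) u v ⟩
  subtype-≡ {A = A} {B} h {x , y} {x′ , y′} p =
    J A (λ x′ _ → Π′ (B x′) λ y′ → Id (Σ′ A B) (x , y) (x′ , y′))
      (λ y′ → ap (λ z → x , z) (h x y y′)) p y′

  reflexive-relation→isSet :
    {A : Type ℓ} (R : ⟨ A ⟩ → ⟨ A ⟩ → Type ℓ) → (∀ x y → ⟨ isProp (R x y) ⟩) →
    (∀ x → ⟨ R x x ⟩) → (∀ x y → ⟨ R x y ⇒ Id A x y ⟩) → ⟨ isSet A ⟩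
  reflexive-relation→isSet {A = A} R prop ρ f x y = isProp→level1 λ p q →
    sym (eq p (transport (R x) p (ρ x))) ∙ eq q (transport (R x) p (ρ x))
    where
    eq : ∀ {y} (p : ⟨ Id A x y ⟩) (s : ⟨ R x y ⟩) →
         ⟨ Id (Id A x y) (sym (f x x (ρ x)) ∙ f x y s) p ⟩
    eq = J A (λ y p → Π′ (R x y) λ s → Id (Id A x y) (sym (f x x (ρ x)) ∙ f x y s) p)
      (λ s → ap (λ s → sym (f x x (ρ x)) ∙ f x x s) (prop x x s (ρ x)) ∙ sym-∙ (f x x (ρ x)))

  isSetΠ : {A : Type k} {B : ⟨ A ⟩ → Type ℓ} → (∀ x → ⟨ isSet (B x) ⟩) → ⟨ isSet (Π′ A B) ⟩
  isSetΠ {A = A} {B} h = reflexive-relation→isSet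
    (λ f g → Π′ A λ x → Id (B x) (f x) (g x))
    (λ f g → isPropΠ λ x → level1→isProp (h x (f x) (g x)))
    (λ f x → refl (B x) (f x))
    (λ f g → funext A B f g)

  isSet-subtype : {A : Type ℓ} {B : ⟨ A ⟩ → Type ℓ} → ⟨ isSet A ⟩ → (∀ x → ⟨ isProp (B x) ⟩) →
                  ⟨ isSet (Σ′ A B) ⟩
  isSet-subtype {A = A} {B} h prop = reflexive-relation→isSet
    (λ u v → Id A (proj₁ u) (proj₁ v))
    (λ u v → level1→isProp (h (proj₁ u) (proj₁ v)))
    (λ u → refl A (proj₁ u))
    (λ u v → subtype-≡ prop)

  Fin : ℕ → Type lzero
  Fin zero    = ⊥′
  Fin (suc n) = ⊤′ ⊎′ Fin n

  isSetFin : ∀ n → ⟨ isSet (Fin n) ⟩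
  isSetFin n = reflexive-relation→isSet (R n) (R-prop n) (R-refl n) (R→Id n)
    where
    R : ∀ n → ⟨ Fin n ⟩ → ⟨ Fin n ⟩ → Type lzero
    R (suc n) (inj₁ _) (inj₁ _) = ⊤′
    R (suc n) (inj₁ _) (inj₂ _) = ⊥′
    R (suc n) (inj₂ _) (inj₁ _) = ⊥′
    R (suc n) (inj₂ i) (inj₂ j) = R n i j

    R-prop : ∀ n i j → ⟨ isProp (R n i j) ⟩
    R-prop (suc n) (inj₁ _) (inj₁ _) = λ x y → refl ⊤′ tt
    R-prop (suc n) (inj₁ _) (inj₂ _) = λ x → ⊥-elim x
    R-prop (suc n) (inj₂ _) (inj₁ _) = λ x → ⊥-elim x
    R-prop (suc n) (inj₂ i) (inj₂ j) = R-prop n i j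

    R-refl : ∀ n i → ⟨ R n i i ⟩
    R-refl (suc n) (inj₁ _) = tt
    R-refl (suc n) (inj₂ i) = R-refl n i

    R→Id : ∀ n i j → ⟨ R n i j ⇒ Id (Fin n) i j ⟩
    R→Id (suc n) (inj₁ _) (inj₁ _) _ = refl (Fin (suc n)) (inj₁ tt)
    R→Id (suc n) (inj₂ i) (inj₂ j) r = ap inj₂ (R→Id n i j r)

  -- Fin n is a set, so a two-sided inverse is unique and no coherence between
  -- the two homotopies is needed.
  isPermutation : ∀ n → ⟨ Fin n ⇒ Fin n ⟩ → Type lzero
  isPermutation n f = Σ′ (Fin n ⇒ Fin n) λ g →
    (Π′ (Fin n) λ i → Id (Fin n) (g (f i)) i) ×′ (Π′ (Fin n) λ i → Id (Fin n) (f (g i)) i)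

  isPropIsPermutation : ∀ n f → ⟨ isProp (isPermutation n f) ⟩
  isPropIsPermutation n f (g , gf , fg) (g′ , gf′ , fg′) = subtype-≡
    (λ h (p , q) (p′ , q′) →
      subtype-≡ (λ _ → isPropΠ λ i → level1→isProp (isSetFin n _ _))
        (isPropΠ (λ i → level1→isProp (isSetFin n _ _)) p p′))
    (funext (Fin n) (λ _ → Fin n) g g′ λ i → sym (ap g (fg′ i)) ∙ gf (g′ i))

  Perm : ℕ → Type lzero
  Perm n = Σ′ (Fin n ⇒ Fin n) (isPermutation n)

  module _ {n : ℕ} where
    _$_ : ⟨ Perm n ⟩ → ⟨ Fin n ⟩ → ⟨ Fin n ⟩
    σ $ i = proj₁ σ i

    Perm-≡ : ∀ {σ τ} → (∀ i → ⟨ Id (Fin n) (σ $ i) (τ $ i) ⟩) → ⟨ Id (Perm n) σ τ ⟩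
    Perm-≡ {σ} {τ} h = subtype-≡ (isPropIsPermutation n)
      (funext (Fin n) (λ _ → Fin n) (σ $_) (τ $_) h)

    1ₚ : ⟨ Perm n ⟩
    1ₚ = id , id , refl (Fin n) , refl (Fin n)

    infixl 7 _∘ₚ_

    _∘ₚ_ : ⟨ Perm n ⟩ → ⟨ Perm n ⟩ → ⟨ Perm n ⟩
    (f , f′ , f′f , ff′) ∘ₚ (g , g′ , g′g , gg′) =
      f ∘ g , g′ ∘ f′ ,
      (λ i → ap g′ (f′f (g i)) ∙ g′g i) , (λ i → ap f (gg′ (f′ i)) ∙ ff′ i)

    infix 8 _⁻¹ₚ

    _⁻¹ₚ : ⟨ Perm n ⟩ → ⟨ Perm n ⟩
    (f , f′ , f′f , ff′) ⁻¹ₚ = f′ , f , ff′ , f′f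

    isTransposition : ⟨ Perm n ⟩ → Type lzero
    isTransposition σ =
      Σ′ (Fin n) λ i → Σ′ (Fin n) λ j →
      (Id (Fin n) i j ⇒ ⊥′) ×′ Id (Fin n) (σ $ i) j ×′ Id (Fin n) (σ $ j) i ×′
      (Π′ (Fin n) λ l → (Id (Fin n) l i ⇒ ⊥′) ⇒ (Id (Fin n) l j ⇒ ⊥′) ⇒ Id (Fin n) (σ $ l) l)

    isProductOfTranspositions : ℕ → ⟨ Perm n ⟩ → Type lzero
    isProductOfTranspositions zero    σ = Id (Perm n) σ 1ₚ
    isProductOfTranspositions (suc m) σ =
      Σ′ (Perm n) λ τ → Σ′ (Perm n) λ ρ →
      isTransposition τ ×′ isProductOfTranspositions m ρ ×′ Id (Perm n) σ (τ ∘ₚ ρ)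

    isEven : ⟨ Perm n ⟩ → Type lzero
    isEven σ = Trunc 0 (Σ′ ℕ′ λ m → isProductOfTranspositions (m * 2) σ)

    isPropIsEven : ∀ σ → ⟨ isProp (isEven σ) ⟩
    isPropIsEven σ = level1→isProp (Trunc-level 0 _)

    isEven-1ₚ : ⟨ isEven 1ₚ ⟩
    isEven-1ₚ = trunc 0 _ (0 , refl (Perm n) 1ₚ)

    private
      product-∘ₚ : ∀ m {m′} {σ τ} → ⟨ isProductOfTranspositions m σ ⟩ →
                   ⟨ isProductOfTranspositions m′ τ ⟩ →
                   ⟨ isProductOfTranspositions (m + m′) (σ ∘ₚ τ) ⟩
      product-∘ₚ zero {m′} {σ} {τ} p q =
        transport (isProductOfTranspositions m′)
          (Perm-≡ λ i → sym (ap (_$ (τ $ i)) p)) q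
      product-∘ₚ (suc m) {τ = τ} (π , ρ , h , p , e) q =
        π , ρ ∘ₚ τ , h , product-∘ₚ m p q , Perm-≡ λ i → ap (_$ (τ $ i)) e

      transposition-⁻¹ₚ : ∀ σ → ⟨ isTransposition σ ⟩ → ⟨ isTransposition (σ ⁻¹ₚ) ⟩
      transposition-⁻¹ₚ (f , f′ , f′f , ff′) (i , j , i≠j , p , q , h) =
        i , j , i≠j , sym (ap f′ q) ∙ f′f j , sym (ap f′ p) ∙ f′f i ,
        λ l l≠i l≠j → sym (ap f′ (h l l≠i l≠j)) ∙ f′f l

      product-⁻¹ₚ : ∀ m {σ} → ⟨ isProductOfTranspositions m σ ⟩ →
                    ⟨ isProductOfTranspositions m (σ ⁻¹ₚ) ⟩
      product-⁻¹ₚ zero    p = ap _⁻¹ₚ p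
      product-⁻¹ₚ (suc m) (τ , ρ , h , p , e) =
        transport {A = Perm n} (isProductOfTranspositions (suc m)) (sym (ap _⁻¹ₚ e))
          (≡.subst (λ k → ⟨ isProductOfTranspositions k (ρ ⁻¹ₚ ∘ₚ τ ⁻¹ₚ) ⟩) (+-comm m 1)
            (product-∘ₚ m {τ = τ ⁻¹ₚ} (product-⁻¹ₚ m p)
              (τ ⁻¹ₚ , 1ₚ , transposition-⁻¹ₚ τ h , refl (Perm n) 1ₚ ,
               Perm-≡ λ i → refl (Fin n) _)))

    isEven-∘ₚ : ∀ σ τ → ⟨ isEven σ ⟩ → ⟨ isEven τ ⟩ → ⟨ isEven (σ ∘ₚ τ) ⟩
    isEven-∘ₚ σ τ s t =
      Trunc-elim 0 _ (λ _ → isEven (σ ∘ₚ τ)) (λ _ → Trunc-level 0 _)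
        (λ (m , p) → Trunc-elim 0 _ (λ _ → isEven (σ ∘ₚ τ)) (λ _ → Trunc-level 0 _)
          (λ (m′ , q) → trunc 0 _ (m + m′ ,
            ≡.subst (λ k → ⟨ isProductOfTranspositions k (σ ∘ₚ τ) ⟩)
              (≡.sym (*-distribʳ-+ 2 m m′)) (product-∘ₚ (m * 2) p q)))
          t)
        s

    isEven-⁻¹ₚ : ∀ σ → ⟨ isEven σ ⟩ → ⟨ isEven (σ ⁻¹ₚ) ⟩
    isEven-⁻¹ₚ σ =
      Trunc-elim 0 _ (λ _ → isEven (σ ⁻¹ₚ)) (λ _ → Trunc-level 0 _)
        (λ (m , p) → trunc 0 _ (m , product-⁻¹ₚ (m * 2) p))

  Alternating : ℕ → Group lzero
  Alternating n = record
    { Carrier = Σ′ (Perm n) isEven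
    ; set     = isSet-subtype
                  (isSet-subtype (isSetΠ λ _ → isSetFin n) (isPropIsPermutation n))
                  isPropIsEven
    ; _·_     = λ (σ , s) (τ , t) → σ ∘ₚ τ , isEven-∘ₚ σ τ s t
    ; ε       = 1ₚ , isEven-1ₚ
    ; _⁻¹     = λ (σ , s) → σ ⁻¹ₚ , isEven-⁻¹ₚ σ s
    ; assoc   = λ _ _ _ → Alt-≡ λ i → refl (Fin n) _
    ; unitˡ   = λ _ → Alt-≡ λ i → refl (Fin n) _
    ; unitʳ   = λ _ → Alt-≡ λ i → refl (Fin n) _
    ; invˡ    = λ ((_ , _ , f′f , _) , _) → Alt-≡ f′f
    ; invʳ    = λ ((_ , _ , _ , ff′) , _) → Alt-≡ ff′
    }
    where
    Alt-≡ : ∀ {u v} → (∀ i → ⟨ Id (Fin n) (proj₁ u $ i) (proj₁ v $ i) ⟩) →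
            ⟨ Id (Σ′ (Perm n) isEven) u v ⟩
    Alt-≡ h = subtype-≡ isPropIsEven (Perm-≡ h)

  A₅ : Group lzero
  A₅ = Alternating 5

{-# OPTIONS --safe #-}
module Submission where

-- Send a and b to the permutations α = (0 1 2 3 4) and β = (0 3 1) of A₅, which
-- satisfy α⁵ = β³ = (αβ)² = 1.  Since BA₅ is connected and being 0-connected is a
-- proposition, only the fiber over the base point matters.  As X is connected,
-- every element of that fiber is merely of the form (pt , p) with p a loop, i.e. an
-- element of A₅.  Moving along a and b in X identifies (pt , p) with (pt , α p) and
-- (pt , β p), so it suffices that α and β generate A₅.

open import Agda.Primitive using (Level; lzero; lsuc)
open import Data.Empty using (⊥-elim)
open import Data.List.Base using
  (List; []; _∷_; _++_; foldr; map; replicate; cartesianProductWith; upTo)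
open import Data.List.Relation.Unary.Any as Any using (Any; any?)
open import Data.Nat.Base using (ℕ; zero; suc; _*_)
open import Data.Nat.GeneralisedArithmetic using (fold)
open import Data.Product.Base using (Σ-syntax; _×_; _,_; proj₁; proj₂; uncurry)
open import Data.Sum.Base using (inj₁; inj₂)
import Data.Sum.Properties as Sum
open import Data.Unit.Base using (tt)
import Data.Unit.Properties as Unit
open import Function.Base using (_∘_; id)
open import Relation.Binary.Definitions using (DecidableEquality)
open import Relation.Binary.PropositionalEquality.Core as ≡ using (_≡_; _≢_)
open import Relation.Binary.PropositionalEquality.Properties as ≡ using (subst-sym-subst)
open import Relation.Nullary.Decidable using
  (Dec; yes; no; toWitness; map′; _→-dec_; _×-dec_; ¬?)
open import Defs

module Transposition {ℓ} {A : Set ℓ} (_≟_ : DecidableEquality A) where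

  swap : A → A → A → A
  swap i j l with l ≟ i | l ≟ j
  ... | yes _ | _     = j
  ... | no _  | yes _ = i
  ... | no _  | no _  = l

  swap-left : ∀ i j → swap i j i ≡ j
  swap-left i j with i ≟ i | i ≟ j
  ... | yes _  | _ = ≡.refl
  ... | no i≢i | _ = ⊥-elim (i≢i ≡.refl)

  swap-right : ∀ i j → swap i j j ≡ i
  swap-right i j with j ≟ i | j ≟ j
  ... | yes j≡i | _      = j≡i
  ... | no _    | yes _  = ≡.refl
  ... | no _    | no j≢j = ⊥-elim (j≢j ≡.refl)

  swap-other : ∀ {i j l} → l ≢ i → l ≢ j → swap i j l ≡ l
  swap-other {i} {j} {l} l≢i l≢j with l ≟ i | l ≟ j
  ... | yes l≡i | _       = ⊥-elim (l≢i l≡i)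
  ... | no _    | yes l≡j = ⊥-elim (l≢j l≡j)
  ... | no _    | no _    = ≡.refl

  swap-involutive : ∀ i j l → swap i j (swap i j l) ≡ l
  swap-involutive i j l with l ≟ i | l ≟ j
  ... | yes l≡i | _       = ≡.trans (swap-right i j) (≡.sym l≡i)
  ... | no _    | yes l≡j = ≡.trans (swap-left i j) (≡.sym l≡j)
  ... | no l≢i  | no l≢j  = swap-other l≢i l≢j

module Proof (H : HoTT) where
  open Theory H

  private variable
    k ℓ : Level

  -- Finite types

  infix 4 _≟_

  _≟_ : ∀ {n} → DecidableEquality ⟨ Fin n ⟩
  _≟_ {suc n} = Sum.≡-dec Unit._≟_ (_≟_ {n})

  all? : ∀ {n} {P : ⟨ Fin n ⟩ → Set ℓ} → (∀ i → Dec (P i)) → Dec (∀ i → P i)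
  all? {n = zero}  P? = yes λ ()
  all? {n = suc n} P? = map′
    (λ { (p , q) (inj₁ _) → p ; (p , q) (inj₂ i) → q i })
    (λ p → p (inj₁ tt) , p ∘ inj₂)
    (P? (inj₁ tt) ×-dec all? {n = n} (P? ∘ inj₂))

  Id→≡ : ∀ n {i j} → ⟨ Id (Fin n) i j ⟩ → i ≡ j
  Id→≡ n {i} {j} = decode n i j ∘ J (Fin n) (λ j _ → Code n i j) (code n i)
    where
    Code : ∀ n → ⟨ Fin n ⟩ → ⟨ Fin n ⟩ → Type lzero
    Code (suc n) (inj₁ _) (inj₁ _) = ⊤′
    Code (suc n) (inj₁ _) (inj₂ _) = ⊥′
    Code (suc n) (inj₂ _) (inj₁ _) = ⊥′
    Code (suc n) (inj₂ i) (inj₂ j) = Code n i j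

    code : ∀ n i → ⟨ Code n i i ⟩
    code (suc n) (inj₁ _) = tt
    code (suc n) (inj₂ i) = code n i

    decode : ∀ n i j → ⟨ Code n i j ⟩ → i ≡ j
    decode (suc n) (inj₁ _) (inj₁ _) _ = ≡.refl
    decode (suc n) (inj₂ i) (inj₂ j) c = ≡.cong inj₂ (decode n i j c)

  module _ {n : ℕ} where
    open Transposition (_≟_ {n}) public

    transposition : ⟨ Fin n ⟩ → ⟨ Fin n ⟩ → ⟨ Perm n ⟩
    transposition i j = swap i j , swap i j ,
      (λ l → reflexive (swap-involutive i j l)) , λ l → reflexive (swap-involutive i j l)

    isTransposition-transposition : ∀ {i j} → i ≢ j →
                                    ⟨ isTransposition (transposition i j) ⟩
    isTransposition-transposition {i} {j} i≢j =
      i , j , i≢j ∘ Id→≡ n , reflexive (swap-left i j) , reflexive (swap-right i j) ,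
      λ l l≠i l≠j → reflexive (swap-other (l≠i ∘ reflexive) (l≠j ∘ reflexive))

    isTransposition→swap : ∀ {τ} ((i , j , _) : ⟨ isTransposition τ ⟩) l →
                           ⟨ Id (Fin n) (_$_ {n} τ l) (swap i j l) ⟩
    isTransposition→swap (i , j , _ , p , q , h) l with _≟_ {n} l i | _≟_ {n} l j
    ... | yes ≡.refl | _          = p
    ... | no _       | yes ≡.refl = q
    ... | no l≢i     | no l≢j     = h l (l≢i ∘ Id→≡ n) (l≢j ∘ Id→≡ n)

  -- Generators of A₅

  Alternating-≡ : ∀ n {g h : ⟨ Group.Carrier (Alternating n) ⟩} →
                  (∀ i → ⟨ Id (Fin n) (_$_ {n} (proj₁ g) i) (_$_ {n} (proj₁ h) i) ⟩) →
                  ⟨ Id (Group.Carrier (Alternating n)) g h ⟩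
  Alternating-≡ n h = subtype-≡ isPropIsEven (Perm-≡ h)

  open Group A₅ using () renaming (Carrier to Alt₅; _·_ to _·₅_; ε to ε₅)

  apply₅ : ⟨ Alt₅ ⟩ → ⟨ Fin 5 ⟩ → ⟨ Fin 5 ⟩
  apply₅ g = _$_ {5} (proj₁ g)

  double-transposition : ∀ {n} {i j k l : ⟨ Fin n ⟩} → i ≢ j → k ≢ l →
                         ⟨ Group.Carrier (Alternating n) ⟩
  double-transposition {n} {i} {j} {k} {l} i≢j k≢l =
    transposition {n} i j ∘ₚ transposition {n} k l , trunc 0 _ (1 ,
      transposition i j , transposition k l , isTransposition-transposition i≢j ,
      (transposition k l , 1ₚ , isTransposition-transposition k≢l , refl (Perm n) 1ₚ ,
       Perm-≡ λ m → refl (Fin n) _) ,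
      refl (Perm n) _)

  data Letter : Set where
    α β : Letter

  pattern 0F = inj₁ tt
  pattern 1F = inj₂ 0F
  pattern 2F = inj₂ 1F
  pattern 3F = inj₂ 2F
  pattern 4F = inj₂ 3F

  power : (G : Group ℓ) → let open Group G in ⟨ Carrier ⟩ → ℕ → ⟨ Carrier ⟩
  power G g zero    = Group.ε G
  power G g (suc n) = Group._·_ G (power G g n) g

  -- Explicit tables for ⟦_⟧, which is abstract because nested swaps unfold exponentially.
  move : Letter → ⟨ Fin 5 ⟩ → ⟨ Fin 5 ⟩
  move α 0F = 1F
  move α 1F = 2F
  move α 2F = 3F
  move α 3F = 4F
  move α 4F = 0F
  move β 0F = 3F
  move β 1F = 0F
  move β 2F = 2F
  move β 3F = 1F
  move β 4F = 4F

  abstract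
    ⟦_⟧ : Letter → ⟨ Alt₅ ⟩
    ⟦ α ⟧ = double-transposition {5} {0F} {1F} {1F} {2F} (λ ()) (λ ()) ·₅
            double-transposition {5} {2F} {3F} {3F} {4F} (λ ()) (λ ())
    ⟦ β ⟧ = double-transposition {5} {0F} {1F} {0F} {3F} (λ ()) (λ ())

    apply-move : ∀ x i → apply₅ ⟦ x ⟧ i ≡ move x i
    apply-move α 0F = ≡.refl
    apply-move α 1F = ≡.refl
    apply-move α 2F = ≡.refl
    apply-move α 3F = ≡.refl
    apply-move α 4F = ≡.refl
    apply-move β 0F = ≡.refl
    apply-move β 1F = ≡.refl
    apply-move β 2F = ≡.refl
    apply-move β 3F = ≡.refl
    apply-move β 4F = ≡.refl

  act : List Letter → ⟨ Alt₅ ⟩ → ⟨ Alt₅ ⟩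
  act w g = foldr (λ x → ⟦ x ⟧ ·₅_) g w

  evaluate : List Letter → ⟨ Fin 5 ⟩ → ⟨ Fin 5 ⟩
  evaluate w i = foldr move i w

  apply-act : ∀ w g i → apply₅ (act w g) i ≡ evaluate w (apply₅ g i)
  apply-act []      g i = ≡.refl
  apply-act (x ∷ w) g i =
    ≡.trans (apply-move x (apply₅ (act w g) i)) (≡.cong (move x) (apply-act w g i))

  apply-power : ∀ {g f} → (∀ i → apply₅ g i ≡ f i) →
                ∀ n i → apply₅ (power A₅ g n) i ≡ fold id (_∘ f) n i
  apply-power h zero    i = ≡.refl
  apply-power {g} {f} h (suc n) i =
    ≡.trans (≡.cong (apply₅ (power A₅ g n)) (h i)) (apply-power h n (f i))

  power-≡ε : ∀ {g f} → (∀ i → apply₅ g i ≡ f i) → ∀ n →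
             (∀ i → fold id (_∘ f) n i ≡ i) → ⟨ Id Alt₅ (power A₅ g n) ε₅ ⟩
  power-≡ε h n p = Alternating-≡ 5 λ i → reflexive (≡.trans (apply-power h n i) (p i))

  α⁵≡ε : ⟨ Id Alt₅ (power A₅ ⟦ α ⟧ 5) ε₅ ⟩
  α⁵≡ε = power-≡ε (apply-move α) 5
    λ { 0F → ≡.refl ; 1F → ≡.refl ; 2F → ≡.refl ; 3F → ≡.refl ; 4F → ≡.refl }

  β³≡ε : ⟨ Id Alt₅ (power A₅ ⟦ β ⟧ 3) ε₅ ⟩
  β³≡ε = power-≡ε (apply-move β) 3
    λ { 0F → ≡.refl ; 1F → ≡.refl ; 2F → ≡.refl ; 3F → ≡.refl ; 4F → ≡.refl }

  [αβ]²≡ε : ⟨ Id Alt₅ (power A₅ (⟦ α ⟧ ·₅ ⟦ β ⟧) 2) ε₅ ⟩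
  [αβ]²≡ε = power-≡ε
    (λ i → ≡.trans (apply-move α (apply₅ ⟦ β ⟧ i)) (≡.cong (move α) (apply-move β i))) 2
    λ { 0F → ≡.refl ; 1F → ≡.refl ; 2F → ≡.refl ; 3F → ≡.refl ; 4F → ≡.refl }

  -- A₅ is the union of four double cosets of the subgroup generated by the
  -- 5-cycle α, of sizes 5, 25, 25 and 5.
  doubleCosetRepresentatives : List (List Letter)
  doubleCosetRepresentatives =
    [] ∷ (β ∷ []) ∷ (β ∷ α ∷ α ∷ α ∷ β ∷ []) ∷
    (β ∷ α ∷ α ∷ α ∷ β ∷ α ∷ α ∷ α ∷ α ∷ β ∷ []) ∷ []

  normalForms : List (List Letter)
  normalForms = cartesianProductWith _++_ powers
    (cartesianProductWith _++_ doubleCosetRepresentatives powers)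
    where powers = map (λ n → replicate n α) (upTo 5)

  abstract
    normalForm : ∀ i j → i ≢ j → ∀ k l → k ≢ l →
                 Any (λ w → ∀ m → evaluate w m ≡ swap {5} i j (swap {5} k l m)) normalForms
    normalForm = toWitness
      {a? = all? {n = 5} λ i → all? {n = 5} λ j → ¬? (_≟_ {5} i j) →-dec
            all? {n = 5} λ k → all? {n = 5} λ l → ¬? (_≟_ {5} k l) →-dec
            any?
              (λ w → all? {n = 5} λ m → _≟_ {5} (evaluate w m) (swap {5} i j (swap {5} k l m)))
              normalForms}
      tt

  act-closed : (P : ⟨ Alt₅ ⟩ → Type ℓ) → (∀ x g → ⟨ P g ⟩ → ⟨ P (⟦ x ⟧ ·₅ g) ⟩) →
               ∀ w g → ⟨ P g ⟩ → ⟨ P (act w g) ⟩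
  act-closed P step []      g u = u
  act-closed P step (x ∷ w) g u = step x (act w g) (act-closed P step w g u)

  A₅-induction : (P : ⟨ Alt₅ ⟩ → Type ℓ) → (∀ g → ⟨ isProp (P g) ⟩) → ⟨ P ε₅ ⟩ →
                 (∀ x g → ⟨ P g ⟩ → ⟨ P (⟦ x ⟧ ·₅ g) ⟩) → ∀ g → ⟨ P g ⟩
  A₅-induction P P-prop unit step (σ , even) =
    Trunc-elim 0 _ (λ t → P (σ , t)) (λ t → isProp→level1 (P-prop (σ , t)))
      (λ (m , p) → product m σ p _) even
    where
    product : ∀ m σ → ⟨ isProductOfTranspositions (m * 2) σ ⟩ → ∀ t → ⟨ P (σ , t) ⟩
    product zero σ p t = transport P (Alternating-≡ 5 λ i → sym (ap (λ τ → _$_ {5} τ i) p)) unit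
    product (suc m) σ
      (τ , _ , τ-tr@(i , j , i≠j , _) , (τ′ , ρ , τ′-tr@(k , l , k≠l , _) , p , e′) , e) t =
      transport P
        (Alternating-≡ 5 λ n →
          reflexive (≡.trans (apply-act w g n) (w-eval (_$_ {5} ρ n))) ∙
          (ap (swap {5} i j) (sym (isTransposition→swap {5} {τ′} τ′-tr (_$_ {5} ρ n))) ∙
          (sym (isTransposition→swap {5} {τ} τ-tr _) ∙
          sym (ap (λ π → _$_ {5} π n) e ∙ ap (λ π → _$_ {5} τ (_$_ {5} π n)) e′))))
        (act-closed P step w g (product m ρ p _))
      where
      g : ⟨ Alt₅ ⟩
      g = ρ , trunc 0 _ (m , p)

      found = normalForm i j (i≠j ∘ reflexive) k l (k≠l ∘ reflexive)
      w = proj₁ (Any.satisfied found)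
      w-eval = proj₂ (Any.satisfied found)

  -- Paths

  module _ {A : Type ℓ} where
    ∙-assoc : ∀ {w x y z} (p : ⟨ Id A w x ⟩) (q : ⟨ Id A x y ⟩) (r : ⟨ Id A y z ⟩) →
              ⟨ Id (Id A w z) ((p ∙ q) ∙ r) (p ∙ (q ∙ r)) ⟩
    ∙-assoc p q = J A (λ _ r → Id (Id A _ _) ((p ∙ q) ∙ r) (p ∙ (q ∙ r)))
      (reflexive (≡.trans (∙-refl (p ∙ q)) (≡.cong (p ∙_) (≡.sym (∙-refl q)))))

    sym-∙-cancel : ∀ {x y z} (p : ⟨ Id A x y ⟩) (q : ⟨ Id A y z ⟩) →
                   ⟨ Id (Id A y z) (sym p ∙ (p ∙ q)) q ⟩
    sym-∙-cancel p q =
      sym (∙-assoc (sym p) p q) ∙ (ap (_∙ q) (sym-∙ p) ∙ refl-∙ q)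

    idempotent→refl : ∀ {x} (p : ⟨ Id A x x ⟩) → ⟨ Id (Id A x x) p (p ∙ p) ⟩ →
                      ⟨ Id (Id A x x) p (refl A x) ⟩
    idempotent→refl p h = sym (sym-∙-cancel p p) ∙ (ap (sym p ∙_) (sym h) ∙ sym-∙ p)

    cast : ∀ {x y z} → x ≡ y → ⟨ Id A y z ⟩ → ⟨ Id A x z ⟩
    cast {z = z} e = ≡.subst (λ x → ⟨ Id A x z ⟩) (≡.sym e)

  -- Propositions

  isProp→isSet : {A : Type ℓ} → ⟨ isProp A ⟩ → ⟨ isSet A ⟩
  isProp→isSet h x y = isProp→level1 (isContr→isProp (isProp→level1 h x y))

  isPropIsContr : {A : Type ℓ} → ⟨ isProp (isContr A) ⟩
  isPropIsContr {A = A} u (z′ , h′) = subtype-≡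
    (λ x → isPropΠ λ y → level1→isProp (isProp→isSet (isContr→isProp u) x y))
    (proj₂ u z′)

  isPropIsProp : {A : Type ℓ} → ⟨ isProp (isProp A) ⟩
  isPropIsProp {A = A} f =
    isPropΠ (λ x → isPropΠ λ y → level1→isProp (isProp→isSet {A = A} f x y)) f

  hProp : ∀ ℓ → Type (lsuc ℓ)
  hProp ℓ = Σ′ (𝒰 ℓ) isProp

  isSet-hProp : ⟨ isSet (hProp ℓ) ⟩
  isSet-hProp {ℓ} = reflexive-relation→isSet
    (λ A B → Id (𝒰 ℓ) (proj₁ A) (proj₁ B))
    (λ (A , _) (B , B-prop) p q →
      ap proj₁ (isContr→isProp (univalence A B (idToEquiv q))
        (p , subtype-≡ (λ f → isPropΠ λ y → isPropIsContr)
               (isPropΠ (λ _ → B-prop) (proj₁ (idToEquiv p)) (proj₁ (idToEquiv q))))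
        (q , refl (A ≃ B) (idToEquiv q))))
    (λ A → refl (𝒰 ℓ) (proj₁ A))
    (λ A B → subtype-≡ λ _ → isPropIsProp)

  connected-elim : {B : Type k} → ⟨ is0ConnectedType B ⟩ → (Q : ⟨ B ⟩ → Type ℓ) →
                   (∀ y → ⟨ isProp (Q y) ⟩) → ∀ {x} → ⟨ Q x ⟩ → ∀ y → ⟨ Q y ⟩
  connected-elim {ℓ = ℓ} {B = B} connected Q Q-prop {x} u y =
    ≡.subst (⟨_⟩ ∘ proj₁) (extend-β y)
      (transport (proj₁ ∘ extend) (isContr→isProp connected (trunc 1 B x) (trunc 1 B y))
        (≡.subst (⟨_⟩ ∘ proj₁) (≡.sym (extend-β x)) u))
    where
    extend : ⟨ Trunc 1 B ⟩ → ⟨ hProp ℓ ⟩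
    extend = Trunc-elim 1 B (λ _ → hProp ℓ) (λ _ → isSet-hProp) (λ y → Q y , Q-prop y)

    extend-β : ∀ y → extend (trunc 1 B y) ≡ (Q y , Q-prop y)
    extend-β = Trunc-β 1 B (λ _ → hProp ℓ) (λ _ → isSet-hProp) (λ y → Q y , Q-prop y)

  -- Path-overs in constant families

  module _ {A : Type k} {B : Type ℓ} where
    const : ⟨ A ⟩ → Type ℓ
    const _ = B

    transport-const : ∀ {x y} (p : ⟨ Id A x y ⟩) (u : ⟨ B ⟩) → ⟨ PathOver const p u u ⟩
    transport-const p u = J A (λ _ p → PathOver const p u u) (reflᵈ const u) p

    transport-const-refl : ∀ {x} (u : ⟨ B ⟩) → transport-const (refl A x) u ≡ reflᵈ const u
    transport-const-refl u = J-β A (λ _ p → PathOver const p u u) (reflᵈ const u)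

    over : ∀ {x y u v} (p : ⟨ Id A x y ⟩) → ⟨ Id B u v ⟩ → ⟨ PathOver const p u v ⟩
    over {u = u} p q = transport-const p u ∙ q

    concatᵈ-transport-const : ∀ {x y z} (p : ⟨ Id A x y ⟩) (q : ⟨ Id A y z ⟩) u →
      ⟨ Id (PathOver const (p ∙ q) u u)
           (concatᵈ const (transport-const p u) (transport-const q u))
           (transport-const (p ∙ q) u) ⟩
    concatᵈ-transport-const {x} {y} p q u = J A
      (λ z q → Id (PathOver const (p ∙ q) u u)
        (concatᵈ const (transport-const p u) (transport-const q u))
        (transport-const (p ∙ q) u))
      (base (∙-refl p) (transport-refl const y)
        (J-β A (λ z q → Id B (transport const (p ∙ q) u) (transport const q (transport const p u))) _)
        (transport-const-refl u))
      q
      where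
      base : ∀ {r} {t} (e : r ≡ p) (e′ : t ≡ id) {c d} →
             c ≡ reflexive (≡.trans (≡.cong (λ r → transport const r u) e)
                             (≡.sym (≡.cong (λ t → t (transport const p u)) e′))) →
             d ≡ reflexive (≡.cong (λ t → t u) e′) →
             ⟨ Id (PathOver const r u u) (c ∙ (ap t (transport-const p u) ∙ d)) (transport-const r u) ⟩
      base ≡.refl ≡.refl ≡.refl ≡.refl =
        refl-∙ _ ∙ (reflexive (∙-refl _) ∙ ap-id (transport-const p u))

    concatᵈ-over : ∀ {x y z u v w} (p : ⟨ Id A x y ⟩) (q : ⟨ Id A y z ⟩)
                   (s : ⟨ Id B u v ⟩) (t : ⟨ Id B v w ⟩) →
                   ⟨ Id (PathOver const (p ∙ q) u w)
                        (concatᵈ const (over p s) (over q t)) (over (p ∙ q) (s ∙ t)) ⟩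
    concatᵈ-over {u = u} p q s t = J B
      (λ w t → Id (PathOver const (p ∙ q) u w)
        (concatᵈ const (over p s) (over q t)) (over (p ∙ q) (s ∙ t)))
      (J B
        (λ v s → Id (PathOver const (p ∙ q) u v)
          (concatᵈ const (over p s) (over q (refl B v))) (over (p ∙ q) (s ∙ refl B v)))
        (≡.subst (λ (c , d , e) → ⟨ Id (PathOver const (p ∙ q) u u) (concatᵈ const c d) e ⟩)
          (≡.sym (≡.cong₂ _,_ (∙-refl _) (≡.cong₂ _,_ (∙-refl _)
            (≡.trans (≡.cong (over (p ∙ q)) (∙-refl (refl B u))) (∙-refl _)))))
          (concatᵈ-transport-const p q u))
        s)
      t

    powerᵈ-over : ∀ {x u} (p : ⟨ Id A x x ⟩) (q : ⟨ Id B u u ⟩) n →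
                  ⟨ Id (PathOver const (p ^ n) u u)
                       (powerᵈ const (over p q) n) (over (p ^ n) (q ^ n)) ⟩
    powerᵈ-over p q zero    = reflexive (≡.sym (≡.trans (∙-refl _) (transport-const-refl _)))
    powerᵈ-over p q (suc n) =
      ap (λ t → concatᵈ const t (over p q)) (powerᵈ-over p q n) ∙ concatᵈ-over (p ^ n) p (q ^ n) q

    over-Id : ∀ {x y u v} {p p′ : ⟨ Id A x y ⟩} {q q′ : ⟨ Id B u v ⟩}
              (r : ⟨ Id (Id A x y) p p′ ⟩) →
              ⟨ Id (Id B u v) q q′ ⟩ →
              ⟨ PathOver (λ p → PathOver const p u v) r (over p q) (over p′ q′) ⟩
    over-Id {x} {y} {u} {v} {p} {p′} {q} r h =
      J (Id A x y) (λ p′ r → PathOver (λ p → PathOver const p u v) r (over p q) (over p′ q))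
        (reflᵈ _ _) r ∙ ap (over p′) h

    fiber-path : (f : ⟨ A ⟩ → ⟨ B ⟩) → ∀ {x y z} (p : ⟨ Id A x y ⟩) {l : ⟨ Id B (f x) (f y) ⟩} →
                 ⟨ Id (PathOver const p (f x) (f y)) (apd const f p) (over p l) ⟩ →
                 (q : ⟨ Id B (f y) z ⟩) → ⟨ Id (fiber A B f z) (y , q) (x , l ∙ q) ⟩
    fiber-path f {x} {y} {z} p {l} h q =
      lift p q ∙
      ap (λ l → x , l ∙ q) (ap (sym (transport-const p (f x)) ∙_) h ∙ sym-∙-cancel _ l)
      where
      lift : ∀ {y} (p : ⟨ Id A x y ⟩) (q : ⟨ Id B (f y) z ⟩) →
             ⟨ Id (fiber A B f z) (y , q)
                 (x , (sym (transport-const p (f x)) ∙ apd const f p) ∙ q) ⟩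
      lift = J A
        (λ y p → Π′ (Id B (f y) z) λ q →
          Id (fiber A B f z) (y , q) (x , (sym (transport-const p (f x)) ∙ apd const f p) ∙ q))
        (λ q → ≡.subst
          (λ (c , d) → ⟨ Id (fiber A B f z) (x , q) (x , (sym c ∙ d) ∙ q) ⟩)
          (≡.sym (≡.cong₂ _,_ (transport-const-refl (f x)) (J-β A _ _)))
          (ap (x ,_) (sym (ap (_∙ q) (sym-∙ (reflᵈ const (f x))) ∙ refl-∙ q))))

  -- The higher inductive type

  module _ {X : Type lzero} {c : Constructors X} (hit : IsHIT X c) where
    open Constructors c
    open IsHIT hit

    elim-prop : (P : ⟨ X ⟩ → Type ℓ) → (∀ x → ⟨ isProp (P x) ⟩) → ⟨ P pt ⟩ → ∀ x → ⟨ P x ⟩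
    elim-prop P P-prop u = elim P u
      (P-prop pt _ _ , P-prop pt _ _ , isProp→isSet′ _ _ , isProp→isSet′ _ _)
      where
      isProp→isSet′ : ∀ {x y} → ⟨ isProp (Id (P pt) x y) ⟩
      isProp→isSet′ = level1→isProp (isProp→isSet (P-prop pt) _ _)

    module _ {B : Type ℓ} where
      -- This holds as soon as `ap f` sends some loop at pt to l, up to e.
      Translates : (f : ⟨ X ⟩ → ⟨ B ⟩) → ∀ {u} → f pt ≡ u → ⟨ Id B u u ⟩ → Set ℓ
      Translates f {u} e l = ∀ {z} (q : ⟨ Id B u z ⟩) →
        ⟨ Id (fiber X B f z) (pt , cast e q) (pt , cast e (l ∙ q)) ⟩

      constˣ : ⟨ X ⟩ → Type ℓ
      constˣ = const {A = X} {B = B}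

      rec : ∀ {u} (a′ b′ : ⟨ Id B u u ⟩) →
            ⟨ Id (Id B u u) (a′ ^ 5) (b′ ^ 3) ⟩ → ⟨ Id (Id B u u) (b′ ^ 3) ((a′ ∙ b′) ^ 2) ⟩ →
            Σ[ f ∈ (⟨ X ⟩ → ⟨ B ⟩) ] Σ[ e ∈ f pt ≡ u ] Translates f e a′ × Translates f e b′
      rec {u} a′ b′ r′ s′ = elim constˣ u methods′ , elim-point constˣ u methods′ ,
        translates _ _ (elim-paths constˣ u methods′) ≡.refl ≡.refl
        where
        methods′ : ⟨ Methods c constˣ u ⟩
        methods′ = over a a′ , over b b′ ,
          (ap (transport (Loopsᵈ c constˣ u) r) (powerᵈ-over a a′ 5) ∙
            (over-Id r r′ ∙ sym (powerᵈ-over b b′ 3))) ,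
          (ap (transport (Loopsᵈ c constˣ u) s) (powerᵈ-over b b′ 3) ∙
            (over-Id s s′ ∙ sym
              (ap (λ t → powerᵈ constˣ t 2) (concatᵈ-over a b a′ b′) ∙
               powerᵈ-over (a ∙ b) (a′ ∙ b′) 2)))

        translates : (f : ⟨ X ⟩ → ⟨ B ⟩) → ∀ {u} (e : f pt ≡ u) {m : ⟨ Methods c constˣ u ⟩} →
                     ⟨ Id (Methods c constˣ u)
                         (≡.subst (λ v → ⟨ Methods c constˣ v ⟩) e (methods c constˣ f)) m ⟩ →
                     ∀ {a′ b′} → proj₁ m ≡ over a a′ → proj₁ (proj₂ m) ≡ over b b′ →
                     Translates f e a′ × Translates f e b′
        translates f ≡.refl h a≡ b≡ =
          fiber-path f a (ap proj₁ h ∙ reflexive a≡) ,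
          fiber-path f b (ap (proj₁ ∘ proj₂) h ∙ reflexive b≡)

  -- Classifying types

  module _ {G : Group k} {B : Type ℓ} (BG : IsClassifyingType G B) where
    open Group G
    open IsClassifyingType BG

    loop : ⟨ Carrier ⟩ → ⟨ Id B pt pt ⟩
    loop = proj₁ iso

    loop-ε : ⟨ Id (Id B pt pt) (loop ε) (refl B pt) ⟩
    loop-ε = idempotent→refl (loop ε) (ap loop (sym (unitˡ ε)) ∙ iso-· ε ε)

    loop-power : ∀ g n → ⟨ Id (Id B pt pt) (loop g ^ n) (loop (power G g n)) ⟩
    loop-power g zero    = sym loop-ε
    loop-power g (suc n) = ap (_∙ loop g) (loop-power g n) ∙ sym (iso-· (power G g n) g)

    loop-relation : ∀ {g h} m n → ⟨ Id Carrier (power G g m) (power G h n) ⟩ →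
                    ⟨ Id (Id B pt pt) (loop g ^ m) (loop h ^ n) ⟩
    loop-relation {g} {h} m n p = loop-power g m ∙ (ap loop p ∙ sym (loop-power h n))

  module _ {X : Type lzero} {c : Constructors X} (hit : IsHIT X c)
           {B : Type ℓ} (BA₅ : IsClassifyingType A₅ B) where
    open Constructors c using () renaming (pt to ptˣ)
    open IsClassifyingType BA₅

    ⟦_⟧ᴮ : Letter → ⟨ Id B pt pt ⟩
    ⟦ x ⟧ᴮ = loop BA₅ ⟦ x ⟧

    relation-r : ⟨ Id (Id B pt pt) (⟦ α ⟧ᴮ ^ 5) (⟦ β ⟧ᴮ ^ 3) ⟩
    relation-r = loop-relation BA₅ 5 3 (α⁵≡ε ∙ sym β³≡ε)

    relation-s : ⟨ Id (Id B pt pt) (⟦ β ⟧ᴮ ^ 3) ((⟦ α ⟧ᴮ ∙ ⟦ β ⟧ᴮ) ^ 2) ⟩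
    relation-s = loop-relation BA₅ 3 2 (β³≡ε ∙ sym [αβ]²≡ε) ∙ ap (_^ 2) (iso-· ⟦ α ⟧ ⟦ β ⟧)

    is0Connected-of-generators :
      (f : ⟨ X ⟩ → ⟨ B ⟩) (e : f ptˣ ≡ pt) → (∀ x → Translates hit {B = B} f e ⟦ x ⟧ᴮ) →
      ⟨ is0Connected X B f ⟩
    is0Connected-of-generators f e translates =
      connected-elim connected (λ y → is0ConnectedType (fiber X B f y)) (λ _ → isPropIsContr)
        (center , Trunc-elim 1 F (Id (Trunc 1 F) center)
          (λ t → isProp→isSet (paths-prop t)) (uncurry paths))
      where
      F = fiber X B f pt

      point : ⟨ Alt₅ ⟩ → ⟨ Trunc 1 F ⟩
      point g = trunc 1 F (ptˣ , cast e (loop BA₅ g))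

      center = point ε₅

      paths-prop : ∀ t → ⟨ isProp (Id (Trunc 1 F) center t) ⟩
      paths-prop t = level1→isProp (Trunc-level 1 F center t)

      paths-point : ∀ g → ⟨ Id (Trunc 1 F) center (point g) ⟩
      paths-point = A₅-induction (λ g → Id (Trunc 1 F) center (point g)) (λ _ → paths-prop _)
        (refl _ center)
        λ x g h → h ∙ (ap (trunc 1 F) (translates x (loop BA₅ g)) ∙
          ap (λ l → trunc 1 F (ptˣ , cast e l)) (sym (iso-· ⟦ x ⟧ g)))

      paths-loop : (p : ⟨ Id B pt pt ⟩) → ⟨ Id (Trunc 1 F) center (trunc 1 F (ptˣ , cast e p)) ⟩
      paths-loop p = transport (λ p → Id (Trunc 1 F) center (trunc 1 F (ptˣ , cast e p)))
        (proj₂ (proj₁ (proj₂ iso p))) (paths-point (proj₁ (proj₁ (proj₂ iso p))))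

      paths : ∀ x (p : ⟨ Id B (f x) pt ⟩) → ⟨ Id (Trunc 1 F) center (trunc 1 F (x , p)) ⟩
      paths = elim-prop hit
        (λ x → Π′ (Id B (f x) pt) λ p → Id (Trunc 1 F) center (trunc 1 F (x , p)))
        (λ x → isPropΠ λ p → paths-prop _)
        λ p → ≡.subst (λ p → ⟨ Id (Trunc 1 F) center (trunc 1 F (ptˣ , p)) ⟩)
          (≡.subst-sym-subst e) (paths-loop (≡.subst (λ v → ⟨ Id B v pt ⟩) e p))

    0-connected-map : ⟨ Σ′ (X ⇒ B) (λ f → is0Connected X B f) ⟩
    0-connected-map =
      let f , e , a-translates , b-translates =
            rec hit {B = B} ⟦ α ⟧ᴮ ⟦ β ⟧ᴮ relation-r relation-s in
      f , is0Connected-of-generators f e λ { α → a-translates ; β → b-translates }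

proposition7p4 : (H : HoTT) →
    let open Theory H in
    (X : Type lzero) (c : Constructors X) → IsHIT X c →
    ∀ {ℓ} (BA₅ : Type ℓ) → IsClassifyingType A₅ BA₅ →
    ⟨ Σ′ (X ⇒ BA₅) (λ f → is0Connected X BA₅ f) ⟩
proposition7p4 H X c hit BA₅ classifying = Proof.0-connected-map H hit classifying
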